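{- For any integer $n \geq 0$ (with $a$ denoting a nonnegative integer), $$v_2(B_n(3,1)) = \begin{cases} 1 + v_2(a), & \text{if } n=4a \text{ and } v_2(a) \leq 4, \\ 0, & \text{if } n \equiv 1 \pmod{2}, \\ 1 + v_2(a), & \text{if } n=4a+2 \text{ and } v_2(a) \leq 3. \end{cases}$$ (No assertion is made for values of $n$ not covered by these cases.)
   Context: The sequence $\{B_n(3,1)\}_{n\geq 0}$ is defined by $B_n = B_{n-1}+B_{n-2}+B_{n-3}$ for $n \geq 3$, with $(B_0,B_1,B_2)=(0,1,0)$. $v_2$ denotes the 2-adic order (2-adic valuation), with the convention $v_2(0)=+\infty$. -}

module Defs where

open import Data.List.Base using (filter; upTo)
open import Data.List.Extrema.Nat using (max)
open import Data.Maybe.Base using (zipWith)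
open import Data.Nat.Base using (ℕ; zero; suc; _+_; _^_; _≤_)
open import Data.Nat.Divisibility using (_∣?_)
open import Relation.Nullary.Construct.Add.Supremum using (_⁺; [_]; ⊤⁺)
open import Relation.Binary.Construct.Add.Supremum.NonStrict _≤_ public
  using () renaming (_≤⁺_ to _≤∞_)

-- ⊤⁺ is the value +∞.
ℕ∞ : Set
ℕ∞ = ℕ ⁺

infixl 6 _+∞_

-- ⊤⁺ (that is, nothing) is absorbing under zipWith.
_+∞_ : ℕ∞ → ℕ∞ → ℕ∞
_+∞_ = zipWith _+_

-- The largest k with 2 ^ k ∣ n.  Searching k < n suffices for n > 0,
-- because 2 ^ k ∣ n implies k < 2 ^ k ≤ n.
v₂ : ℕ → ℕ∞
v₂ zero      = ⊤⁺
v₂ n@(suc _) = [ max 0 (filter (λ k → (2 ^ k) ∣? n) (upTo n)) ]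

B : ℕ → ℕ
B 0 = 0
B 1 = 1
B 2 = 0
B (suc (suc (suc n))) = B (suc (suc n)) + B (suc n) + B n

{-# OPTIONS --safe #-}

-- If v₂(m) < k, then v₂(m) depends only on m modulo 2 ^ k.  All the values
-- asserted for v₂(Bₙ) are at most 5, so Bₙ matters only modulo 64, where
-- the sequence has period 128; likewise a matters only modulo 32.  This leaves
-- finitely many cases.
module Submission where

open import Defs
open import Data.List.Base using (List; filter; upTo)
open import Data.List.Extrema.Nat using (max; argmax-all; xs≤max)
open import Data.List.Membership.Propositional.Properties
  using (∈-filter⁺; ∈-filter⁻; ∈-upTo⁺)
open import Data.List.Relation.Unary.All as All using ()
open import Data.Nat.Base
  using (ℕ; zero; suc; _+_; _*_; _%_; _/_; _^_; _∸_; _≤_; _<_; z≤n; s≤s; NonZero)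
open import Data.Nat.Divisibility
  using (_∣_; _∣?_; divides; 1∣_; _∣0; ∣-trans; ∣⇒≤; m∣m*n; %-presˡ-∣; ∣n∣m%n⇒∣m)
open import Data.Nat.DivMod
  using (m≡m%n+[m/n]*n; m%n<n; m%n%n≡m%n; %-distribˡ-+; m∣n⇒o%n%m≡o%m)
open import Data.Nat.Properties
  using (_≟_; ≤-antisym; <-≤-trans; <-irrefl; <⇒≤; ≮⇒≥; m≤n⇒m≤1+n;
         m^n>0; ^-distribˡ-+-*; +-mono-≤; +-assoc; +-comm; +-identityʳ; m+[n∸m]≡n; allUpTo?)
open import Data.Nat.Tactic.RingSolver using (solve-∀)
open import Data.Product.Base using (_×_; _,_; proj₂; ∃-syntax)
open import Data.Vec.Base using (Vec; []; _∷_; head)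
open import Function.Base using (id; _∘_)
open import Function.Strict using (force; force-≡)
open import Relation.Binary.Construct.Add.Supremum.NonStrict _≤_ using () renaming ([_] to [_]≤)
open import Relation.Binary.PropositionalEquality.Core
  using (_≡_; refl; sym; trans; cong; cong₂; subst)
open import Relation.Binary.PropositionalEquality.Properties using (module ≡-Reasoning)
open import Relation.Nullary.Construct.Add.Supremum using ([_])
open import Relation.Nullary.Decidable.Core using (Dec; toWitness; ¬?; _×-dec_; _→-dec_)
open import Relation.Nullary.Negation.Core using (¬_; contradiction)

infix 4 2^_∥_ 2^_∥?_

-- A decidable stand-in for a finite value of `v₂`: it fails for every `k` at `n = 0`, since all
-- powers divide 0.
2^_∥_ : ℕ → ℕ → Set
2^ k ∥ n = 2 ^ k ∣ n × ¬ 2 ^ suc k ∣ n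

2^_∥?_ : ∀ k n → Dec (2^ k ∥ n)
2^ k ∥? n = (2 ^ k ∣? n) ×-dec ¬? (2 ^ suc k ∣? n)

n<2^n : ∀ n → n < 2 ^ n
n<2^n zero    = s≤s z≤n
n<2^n (suc n) = subst (suc (suc n) ≤_) (cong (2 ^ n +_) (sym (+-identityʳ (2 ^ n))))
  (+-mono-≤ (m^n>0 2 n) (n<2^n n))

m≤n⇒k^m∣k^n : ∀ k {m n} → m ≤ n → k ^ m ∣ k ^ n
m≤n⇒k^m∣k^n k {m} {n} m≤n =
  subst (k ^ m ∣_) (trans (sym (^-distribˡ-+-* k m (n ∸ m))) (cong (k ^_) (m+[n∸m]≡n m≤n)))
    (m∣m*n (k ^ (n ∸ m)))

∥-≤ : ∀ {i j n} → 2^ i ∥ n → 2^ j ∥ n → i ≤ j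
∥-≤ (2^i∣n , _) (_ , 2^1+j∤n) = ≮⇒≥ λ j<i → 2^1+j∤n (∣-trans (m≤n⇒k^m∣k^n 2 j<i) 2^i∣n)

∥-unique : ∀ {i j n} → 2^ i ∥ n → 2^ j ∥ n → i ≡ j
∥-unique p q = ≤-antisym (∥-≤ p q) (∥-≤ q p)

v₂-exists : ∀ n → ∃[ k ] v₂ (suc n) ≡ [ k ] × 2^ k ∥ suc n
v₂-exists n = k , refl , 2^k∣1+n , 2^1+k∤1+n
  where
  2^_∣?1+n : ∀ i → Dec (2 ^ i ∣ suc n)
  2^ i ∣?1+n = 2 ^ i ∣? suc n

  exponents : List ℕ
  exponents = filter 2^_∣?1+n (upTo (suc n))

  k : ℕ
  k = max 0 exponents

  2^k∣1+n : 2 ^ k ∣ suc n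
  -- The default 0 of `max` also qualifies, because `2 ^ 0` is 1.
  2^k∣1+n = argmax-all id {P = λ i → 2 ^ i ∣ suc n} {xs = exponents} (1∣ suc n)
    (All.tabulate λ i∈exponents → proj₂ (∈-filter⁻ 2^_∣?1+n {xs = upTo (suc n)} i∈exponents))

  2^1+k∤1+n : ¬ 2 ^ suc k ∣ suc n
  -- Here `suc k < 2 ^ suc k ≤ suc n`, so `suc k` lies in the searched range and would be a listed
  -- exponent above the maximum.
  2^1+k∤1+n 2^1+k∣1+n = <-irrefl refl (All.lookup (xs≤max 0 exponents)
    (∈-filter⁺ 2^_∣?1+n (∈-upTo⁺ (<-≤-trans (n<2^n (suc k)) (∣⇒≤ 2^1+k∣1+n))) 2^1+k∣1+n))

∥⇒v₂≡ : ∀ {k n} → 2^ k ∥ n → v₂ n ≡ [ k ]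
∥⇒v₂≡ {k} {zero}  (_ , 2^1+k∤0) = contradiction ((2 ^ suc k) ∣0) 2^1+k∤0
∥⇒v₂≡ {k} {suc n} k∥1+n with i , v₂≡i , i∥1+n ← v₂-exists n =
  trans v₂≡i (cong [_] (∥-unique i∥1+n k∥1+n))

-- A finite bound excludes `n = 0`, where `v₂` is infinite; hence only the successor clause.
v₂≤⇒∥ : ∀ {k n} → v₂ n ≤∞ [ k ] → ∃[ i ] i ≤ k × 2^ i ∥ n
v₂≤⇒∥ {k} {suc n} v₂≤k with i , v₂≡i , i∥1+n ← v₂-exists n
  with [ i≤k ]≤ ← subst (_≤∞ [ k ]) v₂≡i v₂≤k = i , i≤k , i∥1+n

module _ {k l : ℕ} .{{_ : NonZero (2 ^ l)}} (k<l : k < l) where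

  private
    2^1+k∣2^l : 2 ^ suc k ∣ 2 ^ l
    2^1+k∣2^l = m≤n⇒k^m∣k^n 2 k<l

    2^k∣2^l : 2 ^ k ∣ 2 ^ l
    2^k∣2^l = m≤n⇒k^m∣k^n 2 (<⇒≤ k<l)

  -- Exactness also tests the exponent `suc k`; as `k < l`, both powers divide the modulus, so
  -- reduction affects neither test.
  ∥-% : ∀ {n} → 2^ k ∥ n → 2^ k ∥ n % 2 ^ l
  ∥-% (d , ¬d) = %-presˡ-∣ d 2^k∣2^l , ¬d ∘ ∣n∣m%n⇒∣m 2^1+k∣2^l

  ∥-%⁻ : ∀ {n} → 2^ k ∥ n % 2 ^ l → 2^ k ∥ n
  ∥-%⁻ (d , ¬d) = ∣n∣m%n⇒∣m 2^k∣2^l d , λ d′ → ¬d (%-presˡ-∣ d′ 2^1+k∣2^l)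

-- Without force, entries would be normalised as unshared thunks, in exponential time.
step : Vec ℕ 3 → Vec ℕ 3
step (x ∷ y ∷ z ∷ []) = force ((z + y + x) % 64) λ r → y ∷ z ∷ r ∷ []

-- Three consecutive residues determine the next one, so iteration replaces the branching recursion
-- of `B` and keeps entries below 64.
window : ℕ → Vec ℕ 3
window zero    = 0 ∷ 1 ∷ 0 ∷ []
window (suc n) = step (window n)

window-correct : ∀ n → window n ≡ B n % 64 ∷ B (1 + n) % 64 ∷ B (2 + n) % 64 ∷ []
window-correct zero    = refl
window-correct (suc n) = trans (cong step (window-correct n))
  (trans (force-≡ ((b₂ % 64 + b₁ % 64 + b₀ % 64) % 64) next) (cong next (sym B-%)))
  where
  open ≡-Reasoning
  b₀ = B n
  b₁ = B (1 + n)
  b₂ = B (2 + n)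

  next : ℕ → Vec ℕ 3
  next r = b₁ % 64 ∷ b₂ % 64 ∷ r ∷ []

  B-% : (b₂ + b₁ + b₀) % 64 ≡ (b₂ % 64 + b₁ % 64 + b₀ % 64) % 64
  B-% = begin
    (b₂ + b₁ + b₀) % 64                               ≡⟨ %-distribˡ-+ (b₂ + b₁) b₀ 64 ⟩
    ((b₂ + b₁) % 64 + b₀ % 64) % 64                   ≡⟨ cong₂ (λ s t → (s + t) % 64) (%-distribˡ-+ b₂ b₁ 64) (sym (m%n%n≡m%n b₀ 64)) ⟩
    ((b₂ % 64 + b₁ % 64) % 64 + b₀ % 64 % 64) % 64    ≡⟨ %-distribˡ-+ (b₂ % 64 + b₁ % 64) (b₀ % 64) 64 ⟨
    (b₂ % 64 + b₁ % 64 + b₀ % 64) % 64                ∎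

-- Evaluation shows that 128 steps restore the initial window; as each window depends only on its
-- predecessor, the agreement propagates.
window-shift : ∀ n → window (n + 128) ≡ window n
window-shift zero    = refl
window-shift (suc n) = cong step (window-shift n)

window-periodic : ∀ n q → window (n + q * 128) ≡ window n
window-periodic n zero    = cong window (+-identityʳ n)
window-periodic n (suc q) = begin
  window (n + (128 + q * 128))  ≡⟨ cong (λ m → window (n + m)) (+-comm 128 (q * 128)) ⟩
  window (n + (q * 128 + 128))  ≡⟨ cong window (+-assoc n (q * 128) 128) ⟨
  window (n + q * 128 + 128)    ≡⟨ window-shift (n + q * 128) ⟩
  window (n + q * 128)          ≡⟨ window-periodic n q ⟩
  window n                      ∎
  where open ≡-Reasoning

residue : ℕ → ℕ
residue n = head (window n)

-- The bound on `k` comes from `64 = 2 ^ 6`.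
∥-residue⇒∥-B : ∀ {k} → k < 6 → ∀ {n} r q → n ≡ r + q * 128 → 2^ k ∥ residue r → 2^ k ∥ B n
∥-residue⇒∥-B {k} k<6 r q refl p = ∥-%⁻ k<6
  (subst (2^ k ∥_) (trans (sym (cong head (window-periodic r q))) (cong head (window-correct (r + q * 128)))) p)

-- Checked exhaustively by the decision procedure: 32 values of `a` suffice because `4 * 32` is the
-- period 128.
residue-4a : ∀ {k} → k < 5 → ∀ {a} → a < 32 → 2^ k ∥ a → 2^ suc k ∥ residue (4 * a)
residue-4a k<5 = toWitness {a? = allUpTo? (λ k → allUpTo? (λ a →
  (2^ k ∥? a) →-dec (2^ suc k ∥? residue (4 * a))) 32) 5} _ k<5

residue-odd : ∀ {r} → r < 128 → r % 2 ≡ 1 → 2^ 0 ∥ residue r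
residue-odd = toWitness {a? = allUpTo? (λ r → (r % 2 ≟ 1) →-dec (2^ 0 ∥? residue r)) 128} _

residue-4a+2 : ∀ {k} → k < 4 → ∀ {a} → a < 32 → 2^ k ∥ a → 2^ suc k ∥ residue (4 * a + 2)
residue-4a+2 k<4 = toWitness {a? = allUpTo? (λ k → allUpTo? (λ a →
  (2^ k ∥? a) →-dec (2^ suc k ∥? residue (4 * a + 2))) 32) 4} _ k<4

theorem11 : (n : ℕ) →
    (∀ a → n ≡ 4 * a → v₂ a ≤∞ [ 4 ] → v₂ (B n) ≡ [ 1 ] +∞ v₂ a) ×
    (n % 2 ≡ 1 → v₂ (B n) ≡ [ 0 ]) ×
    (∀ a → n ≡ 4 * a + 2 → v₂ a ≤∞ [ 3 ] → v₂ (B n) ≡ [ 1 ] +∞ v₂ a)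
theorem11 n = case-4a , case-odd , case-4a+2
  where
  shift-4a : ∀ r q → 4 * (r + q * 32) ≡ 4 * r + q * 128
  shift-4a = solve-∀

  shift-4a+2 : ∀ r q → 4 * (r + q * 32) + 2 ≡ 4 * r + 2 + q * 128
  shift-4a+2 = solve-∀

  case-4a : ∀ a → n ≡ 4 * a → v₂ a ≤∞ [ 4 ] → v₂ (B n) ≡ [ 1 ] +∞ v₂ a
  case-4a a n≡4a v₂a≤4 with k , k≤4 , k∥a ← v₂≤⇒∥ {n = a} v₂a≤4 =
    trans (∥⇒v₂≡ {suc k} (∥-residue⇒∥-B (s≤s (s≤s k≤4)) (4 * (a % 32)) (a / 32)
             (trans n≡4a (trans (cong (4 *_) (m≡m%n+[m/n]*n a 32)) (shift-4a (a % 32) (a / 32))))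
             -- Since `32 = 2 ^ 5` and `k < 5`, reducing `a` modulo 32 preserves its exact power of
             -- 2.
             (residue-4a (s≤s k≤4) (m%n<n a 32) (∥-% {l = 5} (s≤s k≤4) k∥a))))
          (cong ([ 1 ] +∞_) (sym (∥⇒v₂≡ {k} k∥a)))

  case-odd : n % 2 ≡ 1 → v₂ (B n) ≡ [ 0 ]
  case-odd n%2≡1 = ∥⇒v₂≡ (∥-residue⇒∥-B (s≤s z≤n) (n % 128) (n / 128) (m≡m%n+[m/n]*n n 128)
    -- Parity survives reduction modulo 128, as `128 = 64 * 2`.
    (residue-odd (m%n<n n 128) (trans (m∣n⇒o%n%m≡o%m 2 128 n (divides 64 refl)) n%2≡1)))

  case-4a+2 : ∀ a → n ≡ 4 * a + 2 → v₂ a ≤∞ [ 3 ] → v₂ (B n) ≡ [ 1 ] +∞ v₂ a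
  case-4a+2 a n≡4a+2 v₂a≤3 with k , k≤3 , k∥a ← v₂≤⇒∥ {n = a} v₂a≤3 =
    trans (∥⇒v₂≡ {suc k} (∥-residue⇒∥-B (s≤s (s≤s (m≤n⇒m≤1+n k≤3))) (4 * (a % 32) + 2) (a / 32)
             (trans n≡4a+2 (trans (cong (λ m → 4 * m + 2) (m≡m%n+[m/n]*n a 32)) (shift-4a+2 (a % 32) (a / 32))))
             (residue-4a+2 (s≤s k≤3) (m%n<n a 32) (∥-% {l = 5} (s≤s (m≤n⇒m≤1+n k≤3)) k∥a))))
          (cong ([ 1 ] +∞_) (sym (∥⇒v₂≡ {k} k∥a)))
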